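{- For all $a,n\in\mathbb{N}$, we have $$W_{3a}(3n-1)\equiv 0\pmod 3\quad\text{and}\quad W_{3a-1}(3n-1)\equiv 0\pmod 3.$$
   Context: $\mathbb{N}$ denotes the positive integers. For integers $n\ge t\ge 0$, define $$h(n,t)=\frac{(2n+1)\,(n+t)!}{(2t+1)!\,(n-t)!},$$ and for non-negative integers $a,n$ define $$W_a(n)=\sum_{\substack{t_1,t_2\ge 0\\ t_1+t_2=2a}}\ \sum_{\substack{n_1\ge t_1,\ n_2\ge t_2\\ \frac{n_1^2+n_1+n_2^2+n_2}{2}=n}}(-1)^{n_1+n_2}h(n_1,t_1)h(n_2,t_2),$$ where $t_1,t_2,n_1,n_2$ are integers. (The values $h(n,t)$ are integers.) -}

module Defs where

open import Data.Integer.Base as ℤ using (ℤ; +_; -1ℤ; 0ℤ)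
open import Data.List.Base using (List; map; foldr; filter; cartesianProduct; upTo)
open import Data.Nat.Base
open import Data.Nat.Combinatorics using (k![n∸k]!∣n!)
open import Data.Nat.Divisibility using (_∣_; ∣m∣n⇒∣m+n; *-monoʳ-∣; _∣0)
open import Data.Nat.DivMod using (m/n*n≡m)
open import Data.Nat.Properties
open import Data.Nat.Tactic.RingSolver using (solve-∀)
open import Data.Product.Base using (_×_; _,_)
open import Relation.Binary.PropositionalEquality
open import Relation.Nullary.Decidable using (_×-dec_)

-- Meant for t ≤ n, where the truncated operations _∸_ and _/_ are exact
-- (see h-exact below).
h : ℕ → ℕ → ℕ
h n t = ((2 * n + 1) * (n + t) ! / ((2 * t + 1) ! * (n ∸ t) !))
          {{(2 * t + 1) !* (n ∸ t) !≢0}}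

sumℤ : List ℤ → ℤ
sumℤ = foldr ℤ._+_ 0ℤ

pairs≤ : ℕ → List (ℕ × ℕ)
pairs≤ N = cartesianProduct (upTo (suc N)) (upTo (suc N))

-- Every solution of t₁ + t₂ = s has t₁ , t₂ ≤ s.
tIndices : ℕ → List (ℕ × ℕ)
tIndices s = filter (λ (t₁ , t₂) → t₁ + t₂ ≟ s) (pairs≤ s)

-- The condition (n₁² + n₁ + n₂² + n₂) / 2 = n is written without the division;
-- by nIndices-bound below it forces n₁ , n₂ ≤ n.
nIndices : ℕ → ℕ → ℕ → List (ℕ × ℕ)
nIndices t₁ t₂ n =
  filter (λ (n₁ , n₂) → (t₁ ≤? n₁) ×-dec (t₂ ≤? n₂) ×-dec
                        (n₁ ^ 2 + n₁ + n₂ ^ 2 + n₂ ≟ 2 * n))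
         (pairs≤ n)

W : ℕ → ℕ → ℤ
W a n =
  sumℤ (map (λ (t₁ , t₂) →
    sumℤ (map (λ (n₁ , n₂) →
      -1ℤ ℤ.^ (n₁ + n₂) ℤ.* + h n₁ t₁ ℤ.* + h n₂ t₂)
      (nIndices t₁ t₂ n)))
    (tIndices (2 * a)))

h-exact : ∀ {n t} → t ≤ n →
          h n t * ((2 * t + 1) ! * (n ∸ t) !) ≡ (2 * n + 1) * (n + t) !
h-exact {n} {t} t≤n with m , refl ← m≤n⇒∃[o]m+o≡n t≤n =
  m/n*n≡m {{(2 * t + 1) !* (t + m ∸ t) !≢0}}
    (subst₂ (λ x y → (2 * t + 1) ! * x ! ∣ y) (sym (m+n∸m≡n t m)) total
      (∣m∣n⇒∣m+n upper (lower m)))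
  where
  div : ∀ k m → k ! * m ! ∣ (k + m) !
  div k m = subst (λ x → k ! * x ! ∣ (k + m) !) (m+n∸m≡n k m)
              (k![n∸k]!∣n! (m≤m+n k m))

  1+N≡ : ∀ t m → 2 * t + 1 + m ≡ suc (t + m + t)
  1+N≡ = solve-∀

  upper : (2 * t + 1) ! * m ! ∣ suc (t + m + t) * (t + m + t) !
  upper = subst (λ x → (2 * t + 1) ! * m ! ∣ x !) (1+N≡ t m) (div (2 * t + 1) m)

  N≡ : ∀ t m → 2 * t + 1 + m ≡ t + suc m + t
  N≡ = solve-∀

  swap : ∀ x y z → x * (y * z) ≡ y * (x * z)
  swap = solve-∀

  lower : ∀ m → (2 * t + 1) ! * m ! ∣ m * (t + m + t) !
  lower zero    = _ ∣0
  lower (suc m) = subst₂ _∣_ (swap (suc m) ((2 * t + 1) !) (m !))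
    (cong (λ x → suc m * x !) (N≡ t m))
    (*-monoʳ-∣ (suc m) (div (2 * t + 1) m))

  coeff : ∀ t m f → (1 + (t + m + t)) * f + m * f ≡ (2 * (t + m) + 1) * f
  coeff = solve-∀

  total : suc (t + m + t) * (t + m + t) ! + m * (t + m + t) !
        ≡ (2 * (t + m) + 1) * (t + m + t) !
  total = coeff t m ((t + m + t) !)

nIndices-bound : ∀ {n₁ n₂ n} → n₁ ^ 2 + n₁ + n₂ ^ 2 + n₂ ≡ 2 * n → n₁ ≤ n × n₂ ≤ n
nIndices-bound {n₁} {n₂} {n} eq =
  *-cancelˡ-≤ 2 (≤-trans (twice n₁) (≤-trans (m≤m+n _ (n₂ ^ 2 + n₂)) sum≤)) ,
  *-cancelˡ-≤ 2 (≤-trans (twice n₂) (≤-trans (m≤n+m _ (n₁ ^ 2 + n₁)) sum≤))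
  where
  sum≤ : n₁ ^ 2 + n₁ + (n₂ ^ 2 + n₂) ≤ 2 * n
  sum≤ = ≤-reflexive (trans (sym (+-assoc (n₁ ^ 2 + n₁) (n₂ ^ 2) n₂)) eq)

  twice : ∀ m → 2 * m ≤ m ^ 2 + m
  twice zero      = z≤n
  twice m@(suc _) = +-mono-≤ (m≤m*n m (m * 1)) (≤-reflexive (+-identityʳ m))

{-# OPTIONS --safe #-}

-- Put N = 3n − 1.  The index condition says (2n₁+1)² + (2n₂+1)² = 2(4N + 1),
-- which is divisible by 3; as −1 is not a square modulo 3, 3 divides both
-- 2n₁+1 and 2n₂+1.  Since (2t+1) h(n,t) = (2n+1) C(n+t,2t), a summand prime
-- to 3 needs 3 ∣ 2t₁+1 and 3 ∣ 2t₂+1, hence 3 divides their sum 2(2a′ + 1),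
-- where a′ is the index of W; this fails for a′ ≡ 0 , 2 (mod 3).
module Submission where

open import Defs
open import Data.Empty using (⊥-elim)
open import Data.Integer.Base as ℤ using (ℤ; +_; -1ℤ)
open import Data.Integer.Divisibility.Signed using (_∣_)
import Data.Integer.Divisibility.Signed as ℤ∣
open import Data.List.Base using (List; []; _∷_; map)
open import Data.List.Membership.Propositional using (_∈_)
open import Data.List.Membership.Propositional.Properties using (∈-filter⁻)
open import Data.List.Relation.Unary.Any using (here; there)
open import Data.Nat.Base
open import Data.Nat.Combinatorics using (k![n∸k]!∣n!)
open import Data.Nat.Divisibility as ℕ∣ using (divides; _∣?_)
open import Data.Nat.Primality using (Prime; prime?; euclidsLemma)
open import Data.Nat.Properties
open import Data.Nat.Tactic.RingSolver using (solve-∀)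
open import Data.Product.Base using (∃; _×_; _,_; proj₂)
open import Data.Sum.Base using (_⊎_; inj₁; inj₂; [_,_]′; reduce)
open import Relation.Binary.PropositionalEquality
open import Relation.Nullary using (¬_)
open import Relation.Nullary.Decidable using (_×-dec_; from-yes; from-no)

prime-3 : Prime 3
prime-3 = from-yes (prime? 3)

-- Induction in steps of 3: the base cases are the three residues, and (m + 3)² differs from m² by
-- 6m + 9, a multiple of 3.
3∣m⊎m²≡1 : ∀ m → 3 ℕ∣.∣ m ⊎ ∃ λ k → m * m ≡ 1 + 3 * k
3∣m⊎m²≡1 0 = inj₁ (3 ℕ∣.∣0)
3∣m⊎m²≡1 1 = inj₂ (0 , refl)
3∣m⊎m²≡1 2 = inj₂ (1 , refl)
3∣m⊎m²≡1 (suc (suc (suc m))) with 3∣m⊎m²≡1 m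
... | inj₁ 3∣m       = inj₁ (ℕ∣.∣m∣n⇒∣m+n ℕ∣.∣-refl 3∣m)
... | inj₂ (k , m²≡) = inj₂ (k + 2 * m + 3 ,
  trans (expand m) (trans (cong (_+ (6 * m + 9)) m²≡) (collect k m)))
  where
  expand : ∀ m → (3 + m) * (3 + m) ≡ m * m + (6 * m + 9)
  expand = solve-∀

  collect : ∀ k m → 1 + 3 * k + (6 * m + 9) ≡ 1 + 3 * (k + 2 * m + 3)
  collect = solve-∀

3∣m²+n²⇒3∣m : ∀ m n → 3 ℕ∣.∣ m * m + n * n → 3 ℕ∣.∣ m
3∣m²+n²⇒3∣m m n 3∣ with 3∣m⊎m²≡1 m | 3∣m⊎m²≡1 n
... | inj₁ 3∣m       | _              = 3∣m
... | inj₂ _         | inj₁ 3∣n       =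
  reduce (euclidsLemma m m prime-3
    (ℕ∣.∣m+n∣m⇒∣n (subst (3 ℕ∣.∣_) (+-comm (m * m) (n * n)) 3∣) (ℕ∣.∣n⇒∣m*n n 3∣n)))
-- Two squares prime to 3 add up to 1 + 1 = 2 modulo 3, against the hypothesis.
... | inj₂ (k , m²≡) | inj₂ (l , n²≡) = ⊥-elim (from-no (3 ∣? 2)
  (ℕ∣.∣m+n∣m⇒∣n (subst (3 ℕ∣.∣_) (trans (cong₂ _+_ m²≡ n²≡) (collect k l)) 3∣)
    (ℕ∣.m∣m*n (k + l))))
  where
  collect : ∀ k l → 1 + 3 * k + (1 + 3 * l) ≡ 3 * (k + l) + 2
  collect = solve-∀

-- The cofactor is the binomial coefficient C(n+t, 2t), obtained as the quotient `c`. With n = t +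
-- m, both sides are compared after multiplication by (2t)! m!, so that `h-exact` can remove the
-- division hidden in `h`.
2n+1∣h*[2t+1] : ∀ {n t} → t ≤ n → 2 * n + 1 ℕ∣.∣ h n t * (2 * t + 1)
2n+1∣h*[2t+1] {n} {t} t≤n with m , refl ← m≤n⇒∃[o]m+o≡n t≤n =
  divides c (*-cancelʳ-≡ _ _ ((2 * t) ! * m !) {{(2 * t) !* m !≢0}} (begin
    H * (2 * t + 1) * ((2 * t) ! * m !)     ≡⟨ regroup H (2 * t) ((2 * t) !) (m !) ⟩
    -- By definition `suc (2 * t) * (2 * t) !` is a factorial, so only its argument has to be
    -- rewritten.
    H * (suc (2 * t) * (2 * t) ! * m !)     ≡⟨ cong₂ (λ x y → H * (x ! * y !)) (+-comm 1 (2 * t)) (sym (m+n∸m≡n t m)) ⟩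
    H * ((2 * t + 1) ! * (t + m ∸ t) !)     ≡⟨ h-exact t≤n ⟩
    (2 * (t + m) + 1) * (t + m + t) !       ≡⟨ cong ((2 * (t + m) + 1) *_) (ℕ∣._∣_.equality [2t]!*∣[n+t]!) ⟩
    (2 * (t + m) + 1) * (c * ((2 * t) ! * (t + m + t ∸ 2 * t) !))
      ≡⟨ cong (λ x → (2 * (t + m) + 1) * (c * ((2 * t) ! * x !))) n+t∸2t≡m ⟩
    (2 * (t + m) + 1) * (c * ((2 * t) ! * m !))
      ≡⟨ swap (2 * (t + m) + 1) c ((2 * t) ! * m !) ⟩
    c * (2 * (t + m) + 1) * ((2 * t) ! * m !) ∎))
  where
  open ≡-Reasoning
  H : ℕ
  H = h (t + m) t

  2t+m≡ : ∀ t m → 2 * t + m ≡ t + m + t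
  2t+m≡ = solve-∀

  [2t]!*∣[n+t]! : (2 * t) ! * (t + m + t ∸ 2 * t) ! ℕ∣.∣ (t + m + t) !
  [2t]!*∣[n+t]! = k![n∸k]!∣n! (subst (2 * t ≤_) (2t+m≡ t m) (m≤m+n (2 * t) m))

  c : ℕ
  c = ℕ∣.quotient [2t]!*∣[n+t]!

  n+t∸2t≡m : t + m + t ∸ 2 * t ≡ m
  n+t∸2t≡m = trans (cong (_∸ 2 * t) (sym (2t+m≡ t m))) (m+n∸m≡n (2 * t) m)

  regroup : ∀ x s y z → x * (s + 1) * (y * z) ≡ x * ((1 + s) * y * z)
  regroup = solve-∀

  swap : ∀ x y z → x * (y * z) ≡ y * x * z
  swap = solve-∀

prime∣2n+1⇒∣h⊎∣2t+1 : ∀ {p n t} → Prime p → t ≤ n → p ℕ∣.∣ 2 * n + 1 →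
                      p ℕ∣.∣ h n t ⊎ p ℕ∣.∣ 2 * t + 1
prime∣2n+1⇒∣h⊎∣2t+1 {n = n} {t} pr t≤n p∣ =
  euclidsLemma (h n t) (2 * t + 1) pr (ℕ∣.∣-trans p∣ (2n+1∣h*[2t+1] t≤n))

∣sumℤ-map : ∀ {A : Set} {k} (f : A → ℤ) (xs : List A) →
            (∀ {x} → x ∈ xs → k ∣ f x) → k ∣ sumℤ (map f xs)
∣sumℤ-map f []       k∣f = ℤ∣.∣ᵤ⇒∣ (_ ℕ∣.∣0)
∣sumℤ-map f (x ∷ xs) k∣f =
  ℤ∣.∣m∣n⇒∣m+n (k∣f (here refl)) (∣sumℤ-map f xs (λ x∈xs → k∣f (there x∈xs)))

-- Completing the squares turns the index condition into a sum of two squares divisible by 3.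
3∣2n₁+1×3∣2n₂+1 : ∀ n₁ n₂ n → 3 ℕ∣.∣ 4 * n + 1 →
                  n₁ ^ 2 + n₁ + n₂ ^ 2 + n₂ ≡ 2 * n →
                  3 ℕ∣.∣ 2 * n₁ + 1 × 3 ℕ∣.∣ 2 * n₂ + 1
3∣2n₁+1×3∣2n₂+1 n₁ n₂ n 3∣4n+1 eq =
  3∣m²+n²⇒3∣m x y 3∣x²+y² ,
  3∣m²+n²⇒3∣m y x (subst (3 ℕ∣.∣_) (+-comm (x * x) (y * y)) 3∣x²+y²)
  where
  x y : ℕ
  x = 2 * n₁ + 1
  y = 2 * n₂ + 1

  -- `a * (a * 1)` is what `a ^ 2` computes to, so `eq` applies to the right-hand side directly.
  square : ∀ a b → (2 * a + 1) * (2 * a + 1) + (2 * b + 1) * (2 * b + 1)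
                   ≡ 4 * (a * (a * 1) + a + b * (b * 1) + b) + 2
  square = solve-∀

  double : ∀ n → 4 * (2 * n) + 2 ≡ 2 * (4 * n + 1)
  double = solve-∀

  3∣x²+y² : 3 ℕ∣.∣ x * x + y * y
  3∣x²+y² = subst (3 ℕ∣.∣_)
    (sym (trans (square n₁ n₂) (trans (cong (λ z → 4 * z + 2) eq) (double n))))
    (ℕ∣.∣n⇒∣m*n 2 3∣4n+1)

3∤2a+1⇒3∣2t₁+1⇒3∤2t₂+1 : ∀ a t₁ t₂ → t₁ + t₂ ≡ 2 * a → ¬ 3 ℕ∣.∣ 2 * a + 1 →
                          3 ℕ∣.∣ 2 * t₁ + 1 → ¬ 3 ℕ∣.∣ 2 * t₂ + 1
3∤2a+1⇒3∣2t₁+1⇒3∤2t₂+1 a t₁ t₂ eq ∤ d₁ d₂ =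
  [ from-no (3 ∣? 2) , ∤ ]′ (euclidsLemma 2 (2 * a + 1) prime-3
    (subst (3 ℕ∣.∣_) (trans (add t₁ t₂) (trans (cong (λ z → 2 * z + 2) eq) (double a)))
      (ℕ∣.∣m∣n⇒∣m+n d₁ d₂)))
  where
  add : ∀ s t → 2 * s + 1 + (2 * t + 1) ≡ 2 * (s + t) + 2
  add = solve-∀

  double : ∀ a → 2 * (2 * a) + 2 ≡ 2 * (2 * a + 1)
  double = solve-∀

-- Common source of both congruences. Every summand is divisible by 3, so no cancellation between
-- terms is involved: the condition on `n` controls the `2 * nᵢ + 1`, the one on `a` the
-- `2 * tᵢ + 1`.
3∣W : ∀ a n → ¬ 3 ℕ∣.∣ 2 * a + 1 → 3 ℕ∣.∣ 4 * n + 1 → + 3 ∣ W a n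
3∣W a n ∤2a+1 3∣4n+1 =
  ∣sumℤ-map _ (tIndices (2 * a)) λ {(t₁ , t₂)} t∈ →
  ∣sumℤ-map _ (nIndices t₁ t₂ n) λ {(n₁ , n₂)} n∈ →
  let t₁+t₂≡2a = proj₂ (∈-filter⁻ (λ (t₁ , t₂) → t₁ + t₂ ≟ 2 * a) {xs = pairs≤ (2 * a)} t∈)
      t₁≤n₁ , t₂≤n₂ , eq = proj₂ (∈-filter⁻
        (λ (n₁ , n₂) → (t₁ ≤? n₁) ×-dec (t₂ ≤? n₂) ×-dec
                       (n₁ ^ 2 + n₁ + n₂ ^ 2 + n₂ ≟ 2 * n))
        {xs = pairs≤ n} n∈)
  in summand t₁+t₂≡2a t₁≤n₁ t₂≤n₂ (3∣2n₁+1×3∣2n₂+1 n₁ n₂ n 3∣4n+1 eq)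
  where
  summand : ∀ {t₁ t₂ n₁ n₂} → t₁ + t₂ ≡ 2 * a → t₁ ≤ n₁ → t₂ ≤ n₂ →
            3 ℕ∣.∣ 2 * n₁ + 1 × 3 ℕ∣.∣ 2 * n₂ + 1 →
            + 3 ∣ -1ℤ ℤ.^ (n₁ + n₂) ℤ.* + h n₁ t₁ ℤ.* + h n₂ t₂
  summand {t₁} {t₂} {n₁} {n₂} eq t₁≤n₁ t₂≤n₂ (d₁ , d₂)
    with prime∣2n+1⇒∣h⊎∣2t+1 prime-3 t₁≤n₁ d₁ | prime∣2n+1⇒∣h⊎∣2t+1 prime-3 t₂≤n₂ d₂
  ... | inj₁ 3∣h₁ | _         =
    ℤ∣.∣m⇒∣m*n (+ h n₂ t₂) (ℤ∣.∣n⇒∣m*n (-1ℤ ℤ.^ (n₁ + n₂)) (ℤ∣.∣ᵤ⇒∣ 3∣h₁))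
  ... | inj₂ _    | inj₁ 3∣h₂ =
    ℤ∣.∣n⇒∣m*n (-1ℤ ℤ.^ (n₁ + n₂) ℤ.* + h n₁ t₁) (ℤ∣.∣ᵤ⇒∣ 3∣h₂)
  ... | inj₂ e₁   | inj₂ e₂   = ⊥-elim (3∤2a+1⇒3∣2t₁+1⇒3∤2t₂+1 a t₁ t₂ eq ∤2a+1 e₁ e₂)

lemma3p3 : (a n : ℕ) → 1 ≤ a → 1 ≤ n →
    (+ 3 ∣ W (3 * a) (3 * n ∸ 1)) × (+ 3 ∣ W (3 * a ∸ 1) (3 * n ∸ 1))
-- Positivity makes the truncated `∸ 1` exact: 3(k + 1) - 1 = 3k + 2.
lemma3p3 (suc a) (suc n) _ _ =
  3∣W (3 * suc a) (3 * suc n ∸ 1)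
    -- Twice a multiple of 3, plus 1, leaves remainder 1.
    (λ d → from-no (3 ∣? 1) (ℕ∣.∣m+n∣m⇒∣n d (ℕ∣.∣n⇒∣m*n 2 (ℕ∣.m∣m*n (suc a))))) 3∣4N+1 ,
  3∣W (3 * suc a ∸ 1) (3 * suc n ∸ 1)
    -- Here the remainder is 2, since 2(3a + 2) + 1 = 3(2a + 1) + 2.
    (λ d → from-no (3 ∣? 2) (ℕ∣.∣m+n∣m⇒∣n (subst (3 ℕ∣.∣_)
      (trans (cong (λ x → 2 * x + 1) (3k+3∸1≡ a)) (odd a)) d) (ℕ∣.m∣m*n (2 * a + 1)))) 3∣4N+1
  where
  3k+3≡ : ∀ k → 3 * (1 + k) ≡ 3 * k + 2 + 1
  3k+3≡ = solve-∀

  3k+3∸1≡ : ∀ k → 3 * suc k ∸ 1 ≡ 3 * k + 2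
  3k+3∸1≡ k = trans (cong (_∸ 1) (3k+3≡ k)) (m+n∸n≡m (3 * k + 2) 1)

  odd : ∀ k → 2 * (3 * k + 2) + 1 ≡ 3 * (2 * k + 1) + 2
  odd = solve-∀

  four : ∀ k → 4 * (3 * k + 2) + 1 ≡ 3 * (4 * k + 3)
  four = solve-∀

  3∣4N+1 : 3 ℕ∣.∣ 4 * (3 * suc n ∸ 1) + 1
  3∣4N+1 = subst (3 ℕ∣.∣_)
    (sym (trans (cong (λ x → 4 * x + 1) (3k+3∸1≡ n)) (four n))) (ℕ∣.m∣m*n (4 * n + 3))
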